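{- Let $k \ge 2$ be an integer. For integers $m,n\ge 0$, let $D_k(m,n)$ be the number of overpartitions of $n$ with exactly $m$ overlined parts, subject to the following conditions: (i) if an overlined part $\overline{b}$ appears, then all of the non-overlined parts $b, b+1,\dots, b+k-2$ are forbidden to appear; (ii) if an overlined part $\overline{b}$ appears, then all of the overlined parts $\overline{b+1},\overline{b+2},\dots,\overline{b+k-1}$ are forbidden to appear. Then, as an identity of formal power series in $a$ and $q$, \[\sum_{m,n \ge 0} D_k(m,n)\,a^m q^n = \frac{\left(-aq;q^k\right)_{\infty}}{(q;q)_{\infty}}.\]
   Context: An overpartition of a non-negative integer $n$ is a partition of $n$ (a finite multiset of positive integers with sum $n$; the empty partition is the only partition of $0$) in which the last occurrence of each part size may or may not be overlined. Thus each part size $b$ has at most one overlined copy $\overline{b}$ (contributing $b$ to the sum), and any number of non-overlined copies. The $q$-Pochhammer symbol is $(b;q)_t = \prod_{0\le m<t}(1-bq^m)$, where $t$ is a non-negative integer or $\infty$; so $(-aq;q^k)_\infty=\prod_{m\ge 0}(1+aq^{km+1})$ and $(q;q)_\infty=\prod_{m\ge 1}(1-q^m)$. -}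

module Defs where

open import Algebra.Bundles using (CommutativeRing)
import Algebra.Construct.Pointwise as Pointwise
import Algebra.Properties.Semiring.Exp as SemiringExp
import Algebra.Properties.Ring as RingProperties
import Algebra.Properties.Semiring.Sum as SemiringSum
open import Data.Fin.Base as Fin using (toℕ)
import Data.Integer.Base as ℤ
import Data.Integer.Properties as ℤ
open import Data.List.Base
  using (List; []; _∷_; _++_; length; map; filter; upTo; cartesianProductWith)
open import Data.List.Membership.Propositional using (_∈_; _∉_)
open import Data.List.Membership.Propositional.Properties
  using (∈-map⁺; ∈-map⁻; ∈-++⁺ˡ; ∈-++⁺ʳ; ∈-upTo⁺; ∈-filter⁺; ∈-filter⁻;
         ∈-cartesianProductWith⁺; ∈-cartesianProductWith⁻)
open import Data.List.Relation.Unary.All as All using (All; []; _∷_)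
open import Data.List.Relation.Unary.Any using (here; there)
open import Data.List.Relation.Unary.Linked using (Linked; linked?)
open import Data.List.Relation.Unary.Unique.Propositional using (Unique; []; _∷_)
import Data.List.Relation.Unary.Unique.Propositional.Properties as Unique
open import Data.Nat.Base as ℕ using (ℕ; zero; suc; _≤_; _<_; _∸_; z≤n; s≤s)
open import Data.Nat.ListAction using (sum)
import Data.Nat.Properties as ℕ
open import Data.Product.Base using (_×_; _,_; proj₂; ∃-syntax)
open import Data.Vec.Functional using (Vector)
open import Function.Bundles using (_⇔_; mk⇔)
open import Relation.Binary.PropositionalEquality.Core as ≡ using (_≡_)
import Relation.Binary.Reasoning.Setoid as ≈-Reasoning
open import Relation.Nullary.Decidable using (Dec; yes; no; map′; _×-dec_; _→-dec_; ¬?)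
open import Relation.Unary using (Decidable)

data Part : Set where
  plain over : ℕ → Part

size : Part → ℕ
size (plain b) = b
size (over b)  = b

data IsOver : Part → Set where
  isOver : ∀ b → IsOver (over b)

-- An overpartition is written as a weakly decreasing list.  `x ▷ y` says that
-- y may come right after x: an overlined part is the last one of its size,
-- so whatever follows it is strictly smaller.
_▷_ : Part → Part → Set
plain b ▷ y = size y ≤ b
over b  ▷ y = size y < b

isOver? : Decidable IsOver
isOver? (plain b) = no λ ()
isOver? (over b)  = yes (isOver b)

record IsOverpartition (n : ℕ) (π : List Part) : Set where
  field
    positive : All (λ x → 0 < size x) π
    ordered  : Linked _▷_ π
    total    : sum (map size π) ≡ n

record Admissible (k m n : ℕ) (π : List Part) : Set where
  field
    isOverpartition : IsOverpartition n π
    overlined       : length (filter isOver? π) ≡ m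
    noPlain         : ∀ b → over b ∈ π → ∀ c → b ≤ c → c ≤ b ℕ.+ k ∸ 2 → plain c ∉ π
    noOver          : ∀ b → over b ∈ π → ∀ c → b ℕ.+ 1 ≤ c → c ≤ b ℕ.+ k ∸ 1 → over c ∉ π

  open IsOverpartition isOverpartition public

_≟_ : (x y : Part) → Dec (x ≡ y)
plain b ≟ plain c = map′ (≡.cong plain) (λ { ≡.refl → ≡.refl }) (b ℕ.≟ c)
plain b ≟ over c  = no λ ()
over b  ≟ plain c = no λ ()
over b  ≟ over c  = map′ (≡.cong over) (λ { ≡.refl → ≡.refl }) (b ℕ.≟ c)

open import Data.List.Membership.DecPropositional _≟_ using (_∈?_)

_▷?_ : ∀ x y → Dec (x ▷ y)
plain b ▷? y = size y ℕ.≤? b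
over b  ▷? y = size y ℕ.<? b

isOverpartition? : ∀ n → Decidable (IsOverpartition n)
isOverpartition? n π =
  map′ (λ (p , o , t) → record { positive = p ; ordered = o ; total = t })
       (λ P → let open IsOverpartition P in positive , ordered , total)
       (All.all? (λ x → 0 ℕ.<? size x) π
         ×-dec linked? _▷?_ π
         ×-dec sum (map size π) ℕ.≟ n)

private
  between? : ∀ {P : ℕ → Set} → Decidable P →
             ∀ l u → Dec (∀ c → l ≤ c → c ≤ u → P c)
  between? P? l u =
    map′ (λ f c l≤c c≤u → f {c} (s≤s c≤u) l≤c) (λ f {c} c<1+u l≤c → f c l≤c (ℕ.s≤s⁻¹ c<1+u))
         (ℕ.allUpTo? (λ c → l ℕ.≤? c →-dec P? c) (suc u))

  allOver? : ∀ {P : ℕ → Set} → Decidable P →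
             ∀ π → Dec (∀ b → over b ∈ π → P b)
  allOver? P? [] = yes λ b ()
  allOver? P? (plain _ ∷ π) =
    map′ (λ { f b (there i) → f b i }) (λ f b i → f b (there i)) (allOver? P? π)
  allOver? P? (over b ∷ π) =
    map′ (λ { (p , f) _ (here ≡.refl) → p ; (p , f) b′ (there i) → f b′ i })
         (λ f → f b (here ≡.refl) , λ b′ i → f b′ (there i))
         (P? b ×-dec allOver? P? π)

admissible? : ∀ k m n → Decidable (Admissible k m n)
admissible? k m n π =
  map′ (λ (p , o , f , g) → record { isOverpartition = p ; overlined = o ; noPlain = f ; noOver = g })
       (λ A → let open Admissible A in isOverpartition , overlined , noPlain , noOver)
       (isOverpartition? n π
         ×-dec length (filter isOver? π) ℕ.≟ m
         ×-dec allOver? (λ b → between? (λ c → ¬? (plain c ∈? π)) b (b ℕ.+ k ∸ 2)) π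
         ×-dec allOver? (λ b → between? (λ c → ¬? (over c ∈? π)) (b ℕ.+ 1) (b ℕ.+ k ∸ 1)) π)

parts≤ : ℕ → List Part
parts≤ n = map plain (upTo (suc n)) ++ map over (upTo (suc n))

lists≤ : ℕ → List Part → List (List Part)
lists≤ zero    xs = [] ∷ []
lists≤ (suc l) xs = [] ∷ cartesianProductWith _∷_ xs (lists≤ l xs)

-- An overpartition of n has at most n parts, each of size at most n.
admissibles : ℕ → ℕ → ℕ → List (List Part)
admissibles k m n = filter (admissible? k m n) (lists≤ n (parts≤ n))

D : ℕ → ℕ → ℕ → ℕ
D k m n = length (admissibles k m n)

private
  lists≤-unique : ∀ l {xs} → Unique xs → Unique (lists≤ l xs)
  lists≤-unique zero    _  = [] ∷ []
  lists≤-unique (suc l) {xs} xs! =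
    All.tabulate (λ i → λ { ≡.refl → []∉ i }) ∷
    Unique.cartesianProductWith⁺ _∷_ (λ { ≡.refl → ≡.refl , ≡.refl }) xs! (lists≤-unique l xs!)
    where
    []∉ : [] ∉ cartesianProductWith _∷_ xs (lists≤ l xs)
    []∉ i with ∈-cartesianProductWith⁻ _∷_ xs (lists≤ l xs) i
    ... | _ , _ , _ , _ , ()

  parts≤-unique : ∀ n → Unique (parts≤ n)
  parts≤-unique n = Unique.++⁺
    (Unique.map⁺ (λ { ≡.refl → ≡.refl }) (Unique.upTo⁺ (suc n)))
    (Unique.map⁺ (λ { ≡.refl → ≡.refl }) (Unique.upTo⁺ (suc n)))
    disjoint
    where
    disjoint : ∀ {x} → x ∈ map plain (upTo (suc n)) × x ∈ map over (upTo (suc n)) → _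
    disjoint (i , j) with ∈-map⁻ plain i | ∈-map⁻ over j
    ... | _ , _ , ≡.refl | _ , _ , ()

  ∈-parts≤ : ∀ {n} x → size x ≤ n → x ∈ parts≤ n
  ∈-parts≤ (plain b) b≤n = ∈-++⁺ˡ (∈-map⁺ plain (∈-upTo⁺ (s≤s b≤n)))
  ∈-parts≤ (over b)  b≤n = ∈-++⁺ʳ (map plain (upTo (suc _))) (∈-map⁺ over (∈-upTo⁺ (s≤s b≤n)))

  ∈-lists≤ : ∀ l {xs} π → All (_∈ xs) π → length π ≤ l → π ∈ lists≤ l xs
  ∈-lists≤ zero    []      []       _       = here ≡.refl
  ∈-lists≤ (suc l) []      []       _       = here ≡.refl
  ∈-lists≤ (suc l) (x ∷ π) (i ∷ is) (s≤s p) =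
    there (∈-cartesianProductWith⁺ _∷_ i (∈-lists≤ l π is p))

  length≤sum : ∀ π → All (λ x → 0 < size x) π → length π ≤ sum (map size π)
  length≤sum []      []       = z≤n
  length≤sum (x ∷ π) (p ∷ ps) = ℕ.+-mono-≤ p (length≤sum π ps)

  sizes≤sum : ∀ π → All (λ x → size x ≤ sum (map size π)) π
  sizes≤sum []      = []
  sizes≤sum (x ∷ π) =
    ℕ.m≤m+n (size x) _ ∷ All.map (λ p → ℕ.≤-trans p (ℕ.m≤n+m _ (size x))) (sizes≤sum π)

admissibles-unique : ∀ k m n → Unique (admissibles k m n)
admissibles-unique k m n =
  Unique.filter⁺ (admissible? k m n) (lists≤-unique n (parts≤-unique n))

∈-admissibles : ∀ k m n {π} → π ∈ admissibles k m n ⇔ Admissible k m n π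
∈-admissibles k m n {π} = mk⇔
  (λ i → proj₂ (∈-filter⁻ (admissible? k m n) {xs = lists≤ n (parts≤ n)} i))
  (λ A → ∈-filter⁺ (admissible? k m n) (listed A) A)
  where
  listed : Admissible k m n π → π ∈ lists≤ n (parts≤ n)
  listed A with Admissible.total A
  ... | ≡.refl = ∈-lists≤ n π
    (All.map (λ {x} → ∈-parts≤ x) (sizes≤sum π))
    (length≤sum π (Admissible.positive A))

module PowerSeries {c ℓ} (R : CommutativeRing c ℓ) where

  private
    module R where
      open CommutativeRing R public
      open SemiringSum semiring public
      open RingProperties ring public
    open ≈-Reasoning R.setoid

  Series : Set c
  Series = ℕ → R.Carrier

  _≋_ : Series → Series → Set ℓ
  f ≋ g = ∀ n → f n R.≈ g n

  _⊕_ : Series → Series → Series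
  (f ⊕ g) n = f n R.+ g n

  _⊛_ : Series → Series → Series
  (f ⊛ g) n = R.sum {suc n} λ i → f (toℕ i) R.* g (n ∸ toℕ i)

  ⊖_ : Series → Series
  (⊖ f) n = R.- f n

  const : R.Carrier → Series
  const r zero    = r
  const r (suc n) = R.0#

  X : Series
  X zero          = R.0#
  X (suc zero)    = R.1#
  X (suc (suc n)) = R.0#

  private
    tail : Series → Series
    tail f n = f (suc n)

    infix 4 _≈[_]_
    _≈[_]_ : Series → ℕ → Series → Set ℓ
    f ≈[ t ] g = ∀ n → n < t → f n R.≈ g n

    terms : Series → Series → ∀ n → Vector R.Carrier (suc n)
    terms f g n i = f (toℕ i) R.* g (n ∸ toℕ i)

    ⊛-cong : ∀ f f′ g g′ → f ≋ f′ → g ≋ g′ → (f ⊛ g) ≋ (f′ ⊛ g′)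
    ⊛-cong f f′ g g′ p q n = R.sum-cong-≋ {x = terms f g n} {terms f′ g′ n}
      λ i → R.*-cong (p (toℕ i)) (q (n ∸ toℕ i))

    ⊛-congʳ-≤ : ∀ f g g′ n → (∀ j → j ≤ n → g j R.≈ g′ j) → (f ⊛ g) n R.≈ (f ⊛ g′) n
    ⊛-congʳ-≤ f g g′ n p = R.sum-cong-≋ {x = terms f g n} {terms f g′ n}
      λ i → R.*-congˡ (p (n ∸ toℕ i) (ℕ.m∸n≤m n (toℕ i)))

    zeroˡ-⊛ : ∀ f n → ((λ _ → R.0#) ⊛ f) n R.≈ R.0#
    zeroˡ-⊛ f n = R.trans
      (R.sum-cong-≋ {x = terms (λ _ → R.0#) f n} {λ _ → R.0#} λ i → R.zeroˡ _)
      (R.sum-replicate-zero (suc n))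

    zeroʳ-⊛ : ∀ f n → (f ⊛ (λ _ → R.0#)) n R.≈ R.0#
    zeroʳ-⊛ f n = R.trans
      (R.sum-cong-≋ {x = terms f (λ _ → R.0#) n} {λ _ → R.0#} λ i → R.zeroʳ _)
      (R.sum-replicate-zero (suc n))

    identityˡ-⊛ : ∀ f → (const R.1# ⊛ f) ≋ f
    identityˡ-⊛ f zero    = R.trans (R.+-identityʳ _) (R.*-identityˡ _)
    identityˡ-⊛ f (suc n) = R.trans (R.+-cong (R.*-identityˡ _) (zeroˡ-⊛ f n)) (R.+-identityʳ _)

    distribʳ-⊛ : ∀ h f g → ((f ⊕ g) ⊛ h) ≋ ((f ⊛ h) ⊕ (g ⊛ h))
    distribʳ-⊛ h f g n = R.trans
      (R.sum-cong-≋ {x = terms (f ⊕ g) h n} {λ i → terms f h n i R.+ terms g h n i}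
        λ i → R.distribʳ _ _ _)
      (R.∑-distrib-+ (terms f h n) (terms g h n))

    scale-⊛ : ∀ r f g n → ((λ i → r R.* f i) ⊛ g) n R.≈ r R.* (f ⊛ g) n
    scale-⊛ r f g n = R.trans
      (R.sum-cong-≋ {x = terms (λ i → r R.* f i) g n} {λ i → r R.* terms f g n i}
        λ i → R.*-assoc _ _ _)
      (R.sym (R.*-distribˡ-sum r (terms f g n)))

    ⊛-unfoldʳ : ∀ f g n → (f ⊛ g) (suc n) R.≈ f (suc n) R.* g 0 R.+ (f ⊛ tail g) n
    ⊛-unfoldʳ f g zero = begin
      f 0 R.* g 1 R.+ (f 1 R.* g 0 R.+ R.0#)  ≈⟨ R.+-congˡ (R.+-identityʳ _) ⟩
      f 0 R.* g 1 R.+ f 1 R.* g 0             ≈⟨ R.+-comm _ _ ⟩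
      f 1 R.* g 0 R.+ f 0 R.* g 1             ≈⟨ R.+-congˡ (R.+-identityʳ _) ⟨
      f 1 R.* g 0 R.+ (f 0 R.* g 1 R.+ R.0#)  ∎
    ⊛-unfoldʳ f g (suc n) = begin
      x R.+ (tail f ⊛ g) (suc n)            ≈⟨ R.+-congˡ (⊛-unfoldʳ (tail f) g n) ⟩
      x R.+ (y R.+ (tail f ⊛ tail g) n)     ≈⟨ R.+-assoc _ _ _ ⟨
      x R.+ y R.+ (tail f ⊛ tail g) n       ≈⟨ R.+-congʳ (R.+-comm x y) ⟩
      y R.+ x R.+ (tail f ⊛ tail g) n       ≈⟨ R.+-assoc _ _ _ ⟩
      y R.+ (x R.+ (tail f ⊛ tail g) n)     ∎
      where
      x = f 0 R.* g (suc (suc n))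
      y = f (suc (suc n)) R.* g 0

    comm-⊛ : ∀ f g → (f ⊛ g) ≋ (g ⊛ f)
    comm-⊛ f g zero    = R.+-congʳ (R.*-comm _ _)
    comm-⊛ f g (suc n) = R.trans (R.+-cong (R.*-comm _ _) (comm-⊛ (tail f) g n)) (R.sym (⊛-unfoldʳ g f n))

    identityʳ-⊛ : ∀ f → (f ⊛ const R.1#) ≋ f
    identityʳ-⊛ f n = R.trans (comm-⊛ f (const R.1#) n) (identityˡ-⊛ f n)

    distribˡ-⊛ : ∀ h f g → (h ⊛ (f ⊕ g)) ≋ ((h ⊛ f) ⊕ (h ⊛ g))
    distribˡ-⊛ h f g n = begin
      (h ⊛ (f ⊕ g)) n            ≈⟨ comm-⊛ h (f ⊕ g) n ⟩
      ((f ⊕ g) ⊛ h) n            ≈⟨ distribʳ-⊛ h f g n ⟩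
      (f ⊛ h) n R.+ (g ⊛ h) n    ≈⟨ R.+-cong (comm-⊛ f h n) (comm-⊛ g h n) ⟩
      (h ⊛ f) n R.+ (h ⊛ g) n    ∎

    assoc-⊛ : ∀ f g h → ((f ⊛ g) ⊛ h) ≋ (f ⊛ (g ⊛ h))
    assoc-⊛ f g h zero = begin
      (f 0 R.* g 0 R.+ R.0#) R.* h 0 R.+ R.0#    ≈⟨ R.+-congʳ (R.*-congʳ (R.+-identityʳ _)) ⟩
      (f 0 R.* g 0) R.* h 0 R.+ R.0#             ≈⟨ R.+-congʳ (R.*-assoc _ _ _) ⟩
      f 0 R.* (g 0 R.* h 0) R.+ R.0#             ≈⟨ R.+-congʳ (R.*-congˡ (R.+-identityʳ _)) ⟨
      f 0 R.* (g 0 R.* h 0 R.+ R.0#) R.+ R.0#    ∎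
    assoc-⊛ f g h (suc n) = begin
      (f 0 R.* g 0 R.+ R.0#) R.* h (suc n) R.+ (tail (f ⊛ g) ⊛ h) n
        ≈⟨ R.+-cong (R.trans (R.*-congʳ (R.+-identityʳ _)) (R.*-assoc _ _ _))
                    (distribʳ-⊛ h (λ i → f 0 R.* g (suc i)) (tail f ⊛ g) n) ⟩
      f 0 R.* (g 0 R.* h (suc n)) R.+ (((λ i → f 0 R.* g (suc i)) ⊛ h) n R.+ ((tail f ⊛ g) ⊛ h) n)
        ≈⟨ R.+-congˡ (R.+-cong (scale-⊛ (f 0) (tail g) h n) (assoc-⊛ (tail f) g h n)) ⟩
      f 0 R.* (g 0 R.* h (suc n)) R.+ (f 0 R.* (tail g ⊛ h) n R.+ (tail f ⊛ (g ⊛ h)) n)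
        ≈⟨ R.+-assoc _ _ _ ⟨
      f 0 R.* (g 0 R.* h (suc n)) R.+ f 0 R.* (tail g ⊛ h) n R.+ (tail f ⊛ (g ⊛ h)) n
        ≈⟨ R.+-congʳ (R.distribˡ _ _ _) ⟨
      f 0 R.* (g 0 R.* h (suc n) R.+ (tail g ⊛ h) n) R.+ (tail f ⊛ (g ⊛ h)) n
        ∎

  commutativeRing : CommutativeRing c ℓ
  commutativeRing = record
    { Carrier = Series
    ; _≈_     = _≋_
    ; _+_     = _⊕_
    ; _*_     = _⊛_
    ; -_      = ⊖_
    ; 0#      = λ _ → R.0#
    ; 1#      = const R.1#
    ; isCommutativeRing = record
      { isRing = record
        { +-isAbelianGroup = Pointwise.isAbelianGroup ℕ R.+-isAbelianGroup
        ; *-cong           = λ {f f′ g g′} → ⊛-cong f f′ g g′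
        ; *-assoc          = assoc-⊛
        ; *-identity       = identityˡ-⊛ , identityʳ-⊛
        ; distrib          = distribˡ-⊛ , distribʳ-⊛
        }
      ; *-comm = comm-⊛
      }
    }

  private
    module S where
      open CommutativeRing commutativeRing public
      open RingProperties ring public

  open S using (_*_; -_; _-_; 0#; 1#)
  open SemiringExp S.semiring using (_^_)

  -- Every coefficient is eventually constant.
  infix 4 _⟶_
  _⟶_ : (ℕ → Series) → Series → Set ℓ
  s ⟶ f = ∀ n → ∃[ t₀ ] ∀ t → t₀ ≤ t → s t n R.≈ f n

  -- The limit of s, provided that s t and s (suc t) agree below degree t.
  lim : (ℕ → Series) → Series
  lim s n = s (suc n) n

  private
    Settles : (ℕ → Series) → Set ℓ
    Settles s = ∀ t → s (suc t) ≈[ t ] s t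

    settled : ∀ {s} → Settles s → ∀ {t} n → n < t → s t n R.≈ lim s n
    settled {s} p n n<t with ℕ.m≤n⇒∃[o]m+o≡n n<t
    ... | d , ≡.refl = go d
      where
      go : ∀ d → s (suc n ℕ.+ d) n R.≈ lim s n
      go zero    rewrite ℕ.+-identityʳ n = R.refl
      go (suc d) rewrite ℕ.+-suc n d     = R.trans (p _ n (s≤s (ℕ.m≤m+n n d))) (go d)

    lim-correct : ∀ {s} → Settles s → s ⟶ lim s
    lim-correct {s} p n = suc n , λ t n<t → settled {s} p n n<t

    -- Multiplication by a series without constant term gains one degree.
    gain : ∀ h f g t → h 0 R.≈ R.0# → f ≈[ t ] g → (h * f) ≈[ suc t ] (h * g)
    gain h f g t h₀ p n n<1+t = R.trans (drop f n) (R.trans (rest n n<1+t) (R.sym (drop g n)))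
      where
      drop : ∀ f n → (h * f) n R.≈ R.0# R.+ R.sum (λ i → terms h f n (Fin.suc i))
      drop f n = R.+-congʳ (R.trans (R.*-congʳ h₀) (R.zeroˡ _))

      rest : ∀ n → n < suc t →
             R.0# R.+ R.sum (λ i → terms h f n (Fin.suc i)) R.≈
             R.0# R.+ R.sum (λ i → terms h g n (Fin.suc i))
      rest zero    _         = R.refl
      rest (suc n) (s≤s n<t) =
        R.+-congˡ (⊛-congʳ-≤ (tail h) f g n λ j j≤n → p j (ℕ.≤-<-trans j≤n n<t))

  -- The q-Pochhammer symbols (b;x)_t and (b;x)_∞, the latter for x without
  -- constant term.
  ⟨_⍮_⟩_ : Series → Series → ℕ → Series
  ⟨ b ⍮ x ⟩ zero  = 1#
  ⟨ b ⍮ x ⟩ suc t = (⟨ b ⍮ x ⟩ t) * (1# - b * x ^ t)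

  ⟨_⍮_⟩∞ : Series → Series → Series
  ⟨ b ⍮ x ⟩∞ = lim ⟨ b ⍮ x ⟩_

  ⟨⍮⟩∞-correct : ∀ b x → x 0 R.≈ R.0# → (⟨ b ⍮ x ⟩_) ⟶ ⟨ b ⍮ x ⟩∞
  ⟨⍮⟩∞-correct b x x₀ = lim-correct λ t n n<t → R.trans
    (⊛-congʳ-≤ (⟨ b ⍮ x ⟩ t) (1# - b * x ^ t) 1# n λ j j≤n → factor t j (ℕ.≤-<-trans j≤n n<t))
    (identityʳ-⊛ (⟨ b ⍮ x ⟩ t) n)
    where
    power : ∀ t → x ^ t ≈[ t ] 0#
    power (suc t) n n<t = R.trans (gain x (x ^ t) 0# t x₀ (power t) n n<t) (zeroʳ-⊛ x n)

    factor : ∀ t → (1# - b * x ^ t) ≈[ t ] 1#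
    factor t n n<t = begin
      1# n R.- (b * x ^ t) n
        ≈⟨ R.+-congˡ (R.-‿cong (⊛-congʳ-≤ b (x ^ t) 0# n λ j j≤n → power t j (ℕ.≤-<-trans j≤n n<t))) ⟩
      1# n R.- (b * 0#) n     ≈⟨ R.+-congˡ (R.-‿cong (zeroʳ-⊛ b n)) ⟩
      1# n R.- R.0#           ≈⟨ R.+-congˡ R.-0#≈0# ⟩
      1# n R.+ R.0#           ≈⟨ R.+-identityʳ _ ⟩
      1# n                    ∎

  ⟨⍮⟩∞-constant : ∀ b x → b 0 R.≈ R.0# → ⟨ b ⍮ x ⟩∞ 0 R.≈ R.1#
  ⟨⍮⟩∞-constant b x b₀ = begin
    (1# * (1# - b * x ^ 0)) 0                  ≈⟨ identityˡ-⊛ (1# - b * x ^ 0) 0 ⟩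
    R.1# R.- (b 0 R.* (x ^ 0) 0 R.+ R.0#)      ≈⟨ R.+-congˡ (R.-‿cong (R.+-identityʳ _)) ⟩
    R.1# R.- b 0 R.* (x ^ 0) 0                 ≈⟨ R.+-congˡ (R.-‿cong (R.*-congʳ b₀)) ⟩
    R.1# R.- R.0# R.* (x ^ 0) 0                ≈⟨ R.+-congˡ (R.-‿cong (R.zeroˡ _)) ⟩
    R.1# R.- R.0#                              ≈⟨ R.+-congˡ R.-0#≈0# ⟩
    R.1# R.+ R.0#                              ≈⟨ R.+-identityʳ _ ⟩
    R.1#                                       ∎

  -- 1/f = ∑ (1-f)^j, for f with constant term 1.
  geometric : Series → ℕ → Series
  geometric h zero    = 0#
  geometric h (suc t) = 1# S.+ h * geometric h t

  infix 9 1/_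
  1/_ : Series → Series
  1/ f = lim (geometric (1# - f))

  infixl 7 _/_
  _/_ : Series → Series → Series
  f / g = f * 1/ g

  1/-correct : ∀ f → f 0 R.≈ R.1# → f * 1/ f S.≈ 1#
  1/-correct f f₀ n = begin
    (f * lim s) n                                ≈⟨ ⊛-congʳ-≤ f (lim s) (s t) n (λ j j≤n → R.sym (settled {s} settles j (s≤s j≤n))) ⟩
    (f * s t) n                                  ≈⟨ S.*-congʳ {s t} {f} {1# - h} f≈1-h n ⟩
    ((1# - h) * s t) n                           ≈⟨ S.distribʳ (s t) 1# (- h) n ⟩
    (1# * s t) n R.+ (- h * s t) n               ≈⟨ R.+-cong (S.*-identityˡ (s t) n) (R.sym (S.-‿distribˡ-* h (s t) n)) ⟩
    s t n R.- (h * s t) n                        ≈⟨ R.+-congʳ (settles t n (s≤s ℕ.≤-refl)) ⟨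
    (1# n R.+ (h * s t) n) R.- (h * s t) n       ≈⟨ R.+-assoc _ _ _ ⟩
    1# n R.+ ((h * s t) n R.- (h * s t) n)       ≈⟨ R.+-congˡ (R.-‿inverseʳ _) ⟩
    1# n R.+ R.0#                                ≈⟨ R.+-identityʳ _ ⟩
    1# n                                         ∎
    where
    h = 1# - f
    s = geometric h
    t = suc n

    h₀ : h 0 R.≈ R.0#
    h₀ = R.trans (R.+-congˡ (R.-‿cong f₀)) (R.-‿inverseʳ R.1#)

    settles : Settles s
    settles (suc t) n n<t = R.+-congˡ (gain h (s (suc t)) (s t) t h₀ (settles t) n n<t)

    f≈1-h : f S.≈ 1# - h
    f≈1-h n = R.sym (begin
      1# n R.- (1# n R.- f n)         ≈⟨ R.+-congˡ (R.⁻¹-anti-homo-// _ _) ⟩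
      1# n R.+ (f n R.- 1# n)         ≈⟨ R.+-comm _ _ ⟩
      (f n R.- 1# n) R.+ 1# n         ≈⟨ R.+-assoc _ _ _ ⟩
      f n R.+ (R.- 1# n R.+ 1# n)     ≈⟨ R.+-congˡ (R.-‿inverseˡ _) ⟩
      f n R.+ R.0#                    ≈⟨ R.+-identityʳ _ ⟩
      f n                             ∎)

-- ℤ⟦a⟧⟦q⟧: the coefficient of aᵐqⁿ in f is f n m

module ℤ⟦a⟧    = PowerSeries ℤ.+-*-commutativeRing
module ℤ⟦a⟧⟦q⟧ = PowerSeries ℤ⟦a⟧.commutativeRing

open CommutativeRing ℤ⟦a⟧⟦q⟧.commutativeRing public using (_≈_; _*_; -_; 1#)
open SemiringExp (CommutativeRing.semiring ℤ⟦a⟧⟦q⟧.commutativeRing) public using (_^_)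
open ℤ⟦a⟧⟦q⟧ public using (Series; _⟶_; ⟨_⍮_⟩_; ⟨_⍮_⟩∞; 1/_; _/_)

a : Series
a = ℤ⟦a⟧⟦q⟧.const ℤ⟦a⟧.X

q : Series
q = ℤ⟦a⟧⟦q⟧.X

∑D : ℕ → Series
∑D k n m = ℤ.+ D k m n

private
  q^k₀ : ∀ k → 1 ≤ k → CommutativeRing._≈_ ℤ⟦a⟧.commutativeRing ((q ^ k) 0) (λ _ → ℤ.+ 0)
  q^k₀ (suc k) _ = begin
    q 0 R.* (q ^ k) 0 R.+ R.0#   ≈⟨ R.+-identityʳ (q 0 R.* (q ^ k) 0) ⟩
    R.0# R.* (q ^ k) 0           ≈⟨ R.zeroˡ ((q ^ k) 0) ⟩
    R.0#                         ∎
    where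
    module R = CommutativeRing ℤ⟦a⟧.commutativeRing
    open ≈-Reasoning R.setoid

numerator-correct : ∀ k → 1 ≤ k → (⟨ - (a * q) ⍮ q ^ k ⟩_) ⟶ ⟨ - (a * q) ⍮ q ^ k ⟩∞
numerator-correct k 1≤k = ℤ⟦a⟧⟦q⟧.⟨⍮⟩∞-correct (- (a * q)) (q ^ k) (q^k₀ k 1≤k)

denominator-correct : (⟨ q ⍮ q ⟩_) ⟶ ⟨ q ⍮ q ⟩∞
denominator-correct = ℤ⟦a⟧⟦q⟧.⟨⍮⟩∞-correct q q (λ _ → ≡.refl)

denominator-invertible : ⟨ q ⍮ q ⟩∞ * 1/ ⟨ q ⍮ q ⟩∞ ≈ 1#
denominator-invertible = ℤ⟦a⟧⟦q⟧.1/-correct ⟨ q ⍮ q ⟩∞ (ℤ⟦a⟧⟦q⟧.⟨⍮⟩∞-constant q q (λ _ → ≡.refl))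

{-# OPTIONS --safe #-}

-- Let r N be the generating function of the admissible overpartitions whose
-- plain parts b satisfy b ≤ N and whose overlined parts satisfy b + k - 1 ≤ N.
-- Removing the largest part gives
--   r N = r (N-1) + q^N r N + a q^(N-k+1) r (N-k),
-- so that E(x) = ∑ x^N r N satisfies (1-x) E(x) = (1 + a q x^k) E(q x).  Iterating
-- from x = 1, where (1-x) E(x) becomes lim r N, and using E(0) = r 0 = 1, yields
--   lim r N = (1 + a q) E(q) = ... = (-aq; q^k)_∞ / (q; q)_∞.
-- All of this is done modulo powers of q, with E replaced by finite sums.

module Submission where

open import Defs hiding
  (_≟_; _≈_; _*_; -_; 1#; _^_; Series; _⟶_; ⟨_⍮_⟩_; ⟨_⍮_⟩∞; 1/_; _/_; a; q)
open import Algebra.Bundles using (CommutativeRing)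
import Algebra.Properties.CommutativeSemigroup as CommutativeSemigroupProperties
import Algebra.Properties.Ring as RingProperties
import Algebra.Properties.Semiring.Exp as SemiringExp
import Algebra.Properties.Semiring.Sum as SemiringSum
open import Data.Empty using (⊥; ⊥-elim)
open import Data.Fin.Base using (toℕ)
open import Data.Fin.Properties using (toℕ<n)
import Data.Integer.Base as ℤ
import Data.Integer.Properties as ℤ
open import Data.List.Base using (List; []; _∷_; _++_; length; map; filter)
open import Data.List.Membership.Propositional using (_∈_; _∉_)
open import Data.List.Membership.Propositional.Properties
  using (∈-map⁺; ∈-map⁻; ∈-++⁺ˡ; ∈-++⁺ʳ; ∈-++⁻; ∈-filter⁺; ∈-filter⁻)
open import Data.List.Membership.Propositional.Properties.WithK using (unique∧set⇒bag)
open import Data.List.Properties using (length-map; length-++)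
open import Data.List.Relation.Binary.BagAndSetEquality using (∼bag⇒↭)
open import Data.List.Relation.Binary.Permutation.Propositional.Properties using (↭-length)
open import Data.List.Relation.Unary.All as All using (All; []; _∷_)
open import Data.List.Relation.Unary.AllPairs using (AllPairs; []; _∷_)
open import Data.List.Relation.Unary.Any using (here; there)
open import Data.List.Relation.Unary.Linked using (Linked; []; [-]; _∷_)
open import Data.List.Relation.Unary.Linked.Properties using (Linked⇒AllPairs)
open import Data.List.Relation.Unary.Unique.Propositional using (Unique)
import Data.List.Relation.Unary.Unique.Propositional.Properties as Unique
open import Data.Nat.Base as ℕ using (ℕ; zero; suc; _≤_; _<_; _∸_; z≤n; s≤s; s≤s⁻¹; z<s; _⊔_)
open import Data.Nat.ListAction using (sum)
import Data.Nat.Properties as ℕ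
open import Data.Product.Base using (_×_; _,_; proj₁; ∃-syntax)
open import Data.Sum.Base using (inj₁; inj₂)
open import Function.Bundles using (_⇔_; mk⇔; Equivalence)
open import Level using (Level)
open import Relation.Binary.Bundles using (Setoid)
open import Relation.Binary.PropositionalEquality as ≡ using (_≡_; _≢_; refl; sym; trans; cong; cong₂; subst)
import Relation.Binary.Reasoning.Setoid as ≈-Reasoning
open import Relation.Nullary.Decidable using (yes; no; map′; _×-dec_)
open import Relation.Unary using (Decidable)

private variable
  ℓ ℓ′ ℓ″ : Level
  A : Set ℓ
  B : Set ℓ′

-- Delayed sequences and lists without repetitions.

shift : A → ℕ → (ℕ → A) → ℕ → A
shift z zero    f n       = f n
shift z (suc k) f zero    = z
shift z (suc k) f (suc n) = shift z k f n

shift-+ : ∀ (z : A) k f n → shift z k f (k ℕ.+ n) ≡ f n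
shift-+ z zero    f n = refl
shift-+ z (suc k) f n = shift-+ z k f n

-- A delayed sequence may hold lists, their lengths, or coefficients of a series multiplied by a
-- monomial. A termwise relation carries facts from one of these settings to the next, through any
-- nesting of delays.
shift-rel : ∀ (_~_ : A → B → Set ℓ″) {z z′ f g} → z ~ z′ → (∀ j → f j ~ g j) →
            ∀ k n → shift z k f n ~ shift z′ k g n
shift-rel _~_ p ps zero    n       = ps n
shift-rel _~_ p ps (suc k) zero    = p
shift-rel _~_ p ps (suc k) (suc n) = shift-rel _~_ p ps k n

∈-shift⁻ : ∀ {x : A} k f n → x ∈ shift [] k f n → ∃[ j ] n ≡ k ℕ.+ j × x ∈ f j
∈-shift⁻ zero    f n       i = n , refl , i
∈-shift⁻ (suc k) f (suc n) i with ∈-shift⁻ k f n i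
... | j , refl , i′ = j , refl , i′

∈-shift⁺ : ∀ {x : A} k f {j} → x ∈ f j → x ∈ shift [] k f (k ℕ.+ j)
∈-shift⁺ {x = x} k f {j} i = subst (x ∈_) (sym (shift-+ [] k f j)) i

-- Without repetitions, equality as sets is equality as bags, so each list permutes the other.
unique-length : {xs ys : List A} → Unique xs → Unique ys →
                (∀ {x} → x ∈ xs ⇔ x ∈ ys) → length xs ≡ length ys
unique-length xs! ys! same = ↭-length (∼bag⇒↭ (unique∧set⇒bag xs! ys! same))

-- Bounded overpartitions and conditions (i), (ii).

overs : List Part → ℕ
overs π = length (filter isOver? π)

weight : List Part → ℕ
weight π = sum (map size π)

-- For an overlined part this is `b + k - 1 ≤ N`, free of truncated subtraction. It is what
-- condition (i) makes of `b ≤ N` when `over b` stands behind `plain N`.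
Below : ℕ → ℕ → Part → Set
Below k N (plain c) = c ≤ N
Below k N (over b)  = b ℕ.+ k ≤ suc N

Below-mono : ∀ {k M N} x → M ≤ N → Below k M x → Below k N x
Below-mono (plain c) M≤N p = ℕ.≤-trans p M≤N
Below-mono (over b)  M≤N p = ℕ.≤-trans p (s≤s M≤N)

Below⇒size≤ : ∀ {k N} → 2 ≤ k → ∀ x → Below k N x → size x ≤ N
Below⇒size≤ 2≤k (plain c) p = p
Below⇒size≤ {k} 2≤k (over b) p = s≤s⁻¹ (ℕ.≤-trans
  (ℕ.≤-trans (ℕ.≤-reflexive (ℕ.+-comm 1 b)) (ℕ.+-monoʳ-≤ b (ℕ.<⇒≤ 2≤k))) p)

-- For a part of size b+1 in front, all of conditions (i) and (ii) involving it
-- amount to a bound on the rest: b+1 for a plain part, b for an overlined one.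
data Bounded (k : ℕ) : ℕ → List Part → Set where
  []    : ∀ {N} → Bounded k N []
  plain : ∀ {N b π} → b < N → Bounded k (suc b) π → Bounded k N (plain (suc b) ∷ π)
  over  : ∀ {N b π} → b ℕ.+ k ≤ N → Bounded k b π → Bounded k N (over (suc b) ∷ π)

bounded? : ∀ k N → Decidable (Bounded k N)
bounded? k N []                  = yes []
bounded? k N (plain zero ∷ π)    = no λ ()
bounded? k N (plain (suc b) ∷ π) = map′ (λ (p , B) → plain p B) (λ { (plain p B) → p , B })
  (b ℕ.<? N ×-dec bounded? k (suc b) π)
bounded? k N (over zero ∷ π)     = no λ ()
bounded? k N (over (suc b) ∷ π)  = map′ (λ (p , B) → over p B) (λ { (over p B) → p , B })
  (b ℕ.+ k ℕ.≤? N ×-dec bounded? k b π)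

Bounded-mono : ∀ {k M N π} → M ≤ N → Bounded k M π → Bounded k N π
Bounded-mono M≤N []          = []
Bounded-mono M≤N (plain p B) = plain (ℕ.≤-trans p M≤N) B
Bounded-mono M≤N (over p B)  = over (ℕ.≤-trans p M≤N) B

-- The bounds never increase along the list, so the first one dominates all later ones.
Bounded⇒Below : ∀ {k N π} → Bounded k N π → All (Below k N) π
Bounded⇒Below []          = []
Bounded⇒Below (plain p B) = p ∷ All.map (λ {x} → Below-mono x p) (Bounded⇒Below B)
Bounded⇒Below {k} (over {b = b} p B) =
  s≤s p ∷ All.map (λ {x} → Below-mono x (ℕ.≤-trans (ℕ.m≤m+n b k) p)) (Bounded⇒Below B)

▷⇒≥ : ∀ x {y} → x ▷ y → size y ≤ size x
▷⇒≥ (plain b) p = p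
▷⇒≥ (over b)  p = ℕ.<⇒≤ p

▷-trans : ∀ {x y z} → x ▷ y → y ▷ z → x ▷ z
▷-trans {plain b} {y} p r = ℕ.≤-trans (▷⇒≥ y r) p
▷-trans {over b}  {y} p r = ℕ.≤-<-trans (▷⇒≥ y r) p

NoPlain NoOver : ℕ → List Part → Set
NoPlain k π = ∀ b → over b ∈ π → ∀ c → b ≤ c → c ≤ b ℕ.+ k ∸ 2 → plain c ∉ π
NoOver  k π = ∀ b → over b ∈ π → ∀ c → b ℕ.+ 1 ≤ c → c ≤ b ℕ.+ k ∸ 1 → over c ∉ π

module _ {k} (2≤k : 2 ≤ k) where

  private
    k>0 : 1 ≤ k
    k>0 = ℕ.<⇒≤ 2≤k

    ∸2-bound : ∀ {b c} → c ≤ b ℕ.+ k ∸ 2 → 2 ℕ.+ c ≤ b ℕ.+ k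
    ∸2-bound {b} {c} p = ℕ.≤-trans (ℕ.+-monoʳ-≤ 2 p)
      (ℕ.≤-reflexive (ℕ.m+[n∸m]≡n (ℕ.≤-trans 2≤k (ℕ.m≤n+m k b))))

    ∸1-bound : ∀ {b c} → c ≤ b ℕ.+ k ∸ 1 → 1 ℕ.+ c ≤ b ℕ.+ k
    ∸1-bound {b} {c} p = ℕ.≤-trans (ℕ.+-monoʳ-≤ 1 p)
      (ℕ.≤-reflexive (ℕ.m+[n∸m]≡n (ℕ.≤-trans k>0 (ℕ.m≤n+m k b))))

  Bounded⇒positive : ∀ {N π} → Bounded k N π → All (λ x → 0 < size x) π
  Bounded⇒positive []          = []
  Bounded⇒positive (plain _ B) = z<s ∷ Bounded⇒positive B
  Bounded⇒positive (over _ B)  = z<s ∷ Bounded⇒positive B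

  Bounded⇒ordered : ∀ {N π} → Bounded k N π → Linked _▷_ π
  Bounded⇒ordered []          = []
  Bounded⇒ordered (plain {π = []} p B) = [-]
  Bounded⇒ordered (plain {π = y ∷ _} p B) =
    Below⇒size≤ 2≤k y (All.head (Bounded⇒Below B)) ∷ Bounded⇒ordered B
  Bounded⇒ordered (over {π = []} p B) = [-]
  Bounded⇒ordered (over {π = y ∷ _} p B) =
    s≤s (Below⇒size≤ 2≤k y (All.head (Bounded⇒Below B))) ∷ Bounded⇒ordered B

  -- If `plain c` precedes `over b`, the bound on its tail gives `b + k ≤ suc c`, which puts c past
  -- the forbidden range. If `over b` comes first, all plain parts behind it are smaller than b.
  Bounded⇒noPlain : ∀ {N π} → Bounded k N π → NoPlain k π
  Bounded⇒noPlain (plain p B) b (there i) c b≤c c≤ (here refl) =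
    ℕ.<⇒≱ (∸2-bound c≤) (All.lookup (Bounded⇒Below B) i)
  Bounded⇒noPlain (plain p B) b (there i) c b≤c c≤ (there j) = Bounded⇒noPlain B b i c b≤c c≤ j
  Bounded⇒noPlain (over p B) b (here refl) c b≤c c≤ (there j) =
    ℕ.<⇒≱ b≤c (All.lookup (Bounded⇒Below B) j)
  Bounded⇒noPlain (over p B) b (there i) c b≤c c≤ (there j) = Bounded⇒noPlain B b i c b≤c c≤ j

  -- If `over c` precedes `over b`, the bound on its tail gives `b + k ≤ c`, past the forbidden
  -- range. In the opposite order c is smaller than b.
  Bounded⇒noOver : ∀ {N π} → Bounded k N π → NoOver k π
  Bounded⇒noOver (plain p B) b (there i) c b<c c≤ (there j) = Bounded⇒noOver B b i c b<c c≤ j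
  Bounded⇒noOver (over p B) b (here refl) c b<c c≤ (here refl) =
    ℕ.m+1+n≰m b b<c
  Bounded⇒noOver (over p B) b (here refl) c b<c c≤ (there j) =
    ℕ.<⇒≱ (ℕ.≤-trans (ℕ.≤-reflexive (ℕ.+-comm 1 b)) b<c) (ℕ.≤-trans (ℕ.m≤m+n c k) (All.lookup (Bounded⇒Below B) j))
  Bounded⇒noOver (over p B) b (there i) c b<c c≤ (here refl) =
    ℕ.<⇒≱ (∸1-bound c≤) (All.lookup (Bounded⇒Below B) i)
  Bounded⇒noOver (over p B) b (there i) c b<c c≤ (there j) = Bounded⇒noOver B b i c b<c c≤ j

  Bounded⇒Admissible : ∀ {N π} → Bounded k N π → Admissible k (overs π) (weight π) π
  Bounded⇒Admissible B = record
    { isOverpartition = record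
      { positive = Bounded⇒positive B ; ordered = Bounded⇒ordered B ; total = refl }
    ; overlined = refl
    ; noPlain   = Bounded⇒noPlain B
    ; noOver    = Bounded⇒noOver B
    }

  -- An overlined c that broke the bound set by the first part would have that part in its forbidden
  -- range: by (i) if the first part is plain, by (ii) if it is overlined. The first part must be
  -- compared with every later one, hence `AllPairs`.
  Below⇒Bounded : ∀ {N π} → All (λ x → 0 < size x) π → AllPairs _▷_ π →
                  NoPlain k π → NoOver k π → All (Below k N) π → Bounded k N π
  Below⇒Bounded [] [] _ _ [] = []
  Below⇒Bounded {π = plain (suc b) ∷ π} (_ ∷ pos) (b▷ ∷ ord) noPlain noOver (p ∷ _) =
    plain p (Below⇒Bounded pos ord
      (λ b i c b≤c c≤ j → noPlain b (there i) c b≤c c≤ (there j))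
      (λ b i c b≤c c≤ j → noOver b (there i) c b≤c c≤ (there j))
      (All.tabulate λ {x} → below x))
    where
    below : ∀ x → x ∈ π → Below k (suc b) x
    below (plain c) i = All.lookup b▷ i
    below (over c)  i = ℕ.≮⇒≥ λ b<c → noPlain c (there i) (suc b) (All.lookup b▷ i)
      (ℕ.∸-monoˡ-≤ 2 b<c) (here refl)
  Below⇒Bounded {π = over (suc b) ∷ π} (_ ∷ pos) (b▷ ∷ ord) noPlain noOver (p ∷ _) =
    over (s≤s⁻¹ p) (Below⇒Bounded pos ord
      (λ b i c b≤c c≤ j → noPlain b (there i) c b≤c c≤ (there j))
      (λ b i c b≤c c≤ j → noOver b (there i) c b≤c c≤ (there j))
      (All.tabulate λ {x} → below x))
    where
    below : ∀ x → x ∈ π → Below k b x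
    below (plain c) i = s≤s⁻¹ (All.lookup b▷ i)
    below (over c)  i = ℕ.≮⇒≥ λ b<c → noOver c (there i) (suc b)
      (ℕ.≤-trans (ℕ.≤-reflexive (ℕ.+-comm c 1)) (All.lookup b▷ i))
      (ℕ.∸-monoˡ-≤ 1 b<c) (here refl)

  -- No part exceeds the total n, so a bound of at least `n + k - 1` excludes nothing.
  Admissible⇒Bounded : ∀ {m n N π} → n ℕ.+ k ≤ suc N → Admissible k m n π → Bounded k N π
  Admissible⇒Bounded {n = n} {N} {π} n+k≤N A = Below⇒Bounded positive
    (Linked⇒AllPairs (λ {x} {y} {z} → ▷-trans {x} {y} {z}) ordered) noPlain noOver
    (All.tabulate λ {x} i → below x (subst (size x ≤_) total (size≤weight i)))
    where
    open Admissible A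

    size≤weight : ∀ {x π} → x ∈ π → size x ≤ weight π
    size≤weight {x} (here refl) = ℕ.m≤m+n (size x) _
    size≤weight (there {x = y} i) = ℕ.≤-trans (size≤weight i) (ℕ.m≤n+m _ (size y))

    below : ∀ x → size x ≤ n → Below k N x
    below (plain c) p = ℕ.≤-trans p
      (s≤s⁻¹ (ℕ.≤-trans (ℕ.≤-trans (ℕ.≤-reflexive (ℕ.+-comm 1 n)) (ℕ.+-monoʳ-≤ n k>0)) n+k≤N))
    below (over b)  p = ℕ.≤-trans (ℕ.+-monoˡ-≤ k p) n+k≤N

  -- Counting by the largest part.

  bounded : ℕ → ℕ → ℕ → List (List Part)
  bounded N m n = filter (bounded? k N) (admissibles k m n)

  ∈-bounded⁻ : ∀ N m n {π} → π ∈ bounded N m n → Bounded k N π × overs π ≡ m × weight π ≡ n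
  ∈-bounded⁻ N m n i with ∈-filter⁻ (bounded? k N) {xs = admissibles k m n} i
  ... | j , B = B , Admissible.overlined adm , Admissible.total adm
    where adm = Equivalence.to (∈-admissibles k m n) j

  ∈-bounded⁺ : ∀ {N π} → Bounded k N π → π ∈ bounded N (overs π) (weight π)
  ∈-bounded⁺ {N} {π} B = ∈-filter⁺ (bounded? k N)
    (Equivalence.from (∈-admissibles k (overs π) (weight π)) (Bounded⇒Admissible B)) B

  bounded-unique : ∀ N m n → Unique (bounded N m n)
  bounded-unique N m n = Unique.filter⁺ (bounded? k N) (admissibles-unique k m n)

  length-bounded : ∀ {N} m n → n ℕ.+ k ≤ suc N → length (bounded N m n) ≡ D k m n
  length-bounded {N} m n p = unique-length (bounded-unique N m n) (admissibles-unique k m n) (mk⇔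
    (λ i → proj₁ (∈-filter⁻ (bounded? k N) {xs = admissibles k m n} i))
    (λ i → ∈-filter⁺ (bounded? k N) i (Admissible⇒Bounded p (Equivalence.to (∈-admissibles k m n) i))))

  withPlain : ℕ → ℕ → ℕ → List (List Part)
  withPlain N m = shift [] N λ n → map (plain N ∷_) (bounded N m n)

  withOver : ℕ → ℕ → ℕ → List (List Part)
  withOver N m n = shift [] 1 (λ m → shift [] (suc N) (λ n → map (over (suc N) ∷_) (bounded N m n)) n) m

  -- The delay by k encodes that `over (suc b)` attains the bound N exactly when `N = k + b`; for
  -- `N < k` there is no such part.
  withOvers : ℕ → ℕ → ℕ → List (List Part)
  withOvers N m n = shift [] k (λ N → withOver N m n) N

  ∈-withPlain⁻ : ∀ N m n {π} → π ∈ withPlain (suc N) m n →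
                 ∃[ ρ ] π ≡ plain (suc N) ∷ ρ × Bounded k (suc N) ρ × overs π ≡ m × weight π ≡ n
  ∈-withPlain⁻ N m n i with ∈-shift⁻ (suc N) _ n i
  ... | l , refl , j with ∈-map⁻ (plain (suc N) ∷_) j
  ... | ρ , j′ , refl with ∈-bounded⁻ (suc N) m l j′
  ... | B , refl , refl = ρ , refl , B , refl , refl

  ∈-withPlain⁺ : ∀ {N ρ} → Bounded k (suc N) ρ →
                 plain (suc N) ∷ ρ ∈ withPlain (suc N) (overs ρ) (weight (plain (suc N) ∷ ρ))
  ∈-withPlain⁺ {N} B = ∈-shift⁺ (suc N) _ (∈-map⁺ (plain (suc N) ∷_) (∈-bounded⁺ B))

  ∈-withOvers⁻ : ∀ N m n {π} → π ∈ withOvers N m n →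
                 ∃[ b ] ∃[ ρ ] N ≡ k ℕ.+ b × π ≡ over (suc b) ∷ ρ × Bounded k b ρ × overs π ≡ m × weight π ≡ n
  ∈-withOvers⁻ N m n i with ∈-shift⁻ k _ N i
  ... | b , refl , j with ∈-shift⁻ 1 _ m j
  ... | m′ , refl , j′ with ∈-shift⁻ (suc b) _ n j′
  ... | n′ , refl , j″ with ∈-map⁻ (over (suc b) ∷_) j″
  ... | ρ , j‴ , refl with ∈-bounded⁻ b m′ n′ j‴
  ... | B , refl , refl = b , ρ , refl , refl , B , refl , refl

  ∈-withOvers⁺ : ∀ {b ρ} → Bounded k b ρ →
                 over (suc b) ∷ ρ ∈ withOvers (k ℕ.+ b) (suc (overs ρ)) (weight (over (suc b) ∷ ρ))
  ∈-withOvers⁺ {b} {ρ} B = ∈-shift⁺ k (λ N → withOver N (suc (overs ρ)) (weight (over (suc b) ∷ ρ)))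
    (∈-shift⁺ (suc b) _ (∈-map⁺ (over (suc b) ∷_) (∈-bounded⁺ B)))

  -- The three terms of the recurrence as lists: a first part either respects the old bound N
  -- already or attains the new bound, being plain or overlined.
  split : ℕ → ℕ → ℕ → List (List Part)
  split N m n = bounded N m n ++ withPlain (suc N) m n ++ withOvers (suc N) m n

  ∈-split⁻ : ∀ N m n {π} → π ∈ split N m n → π ∈ bounded (suc N) m n
  ∈-split⁻ N m n i with ∈-++⁻ (bounded N m n) i
  ... | inj₁ j with ∈-bounded⁻ N m n j
  ... | B , refl , refl = ∈-bounded⁺ (Bounded-mono (ℕ.n≤1+n N) B)
  ∈-split⁻ N m n i | inj₂ j with ∈-++⁻ (withPlain (suc N) m n) j
  ∈-split⁻ N m n i | inj₂ _ | inj₁ j with ∈-withPlain⁻ N m n j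
  ... | ρ , refl , B , refl , refl = ∈-bounded⁺ (plain ℕ.≤-refl B)
  ∈-split⁻ N m n i | inj₂ _ | inj₂ j with ∈-withOvers⁻ (suc N) m n j
  ... | b , ρ , eq , refl , B , refl , refl =
    ∈-bounded⁺ (over (ℕ.≤-reflexive (trans (ℕ.+-comm b k) (sym eq))) B)

  ∈-split⁺ : ∀ N m n {π} → π ∈ bounded (suc N) m n → π ∈ split N m n
  ∈-split⁺ N m n i with ∈-bounded⁻ (suc N) m n i
  ... | [] , refl , refl = ∈-++⁺ˡ (∈-bounded⁺ {N} {[]} [])
  ... | plain {π = ρ} p B , refl , refl with ℕ.m≤n⇒m<n∨m≡n (s≤s⁻¹ p)
  ... | inj₁ b<N = ∈-++⁺ˡ (∈-bounded⁺ (plain b<N B))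
  ... | inj₂ refl = ∈-++⁺ʳ (bounded N m n) (∈-++⁺ˡ (∈-withPlain⁺ {ρ = ρ} B))
  ∈-split⁺ N m n i | over {b = b} {ρ} p B , refl , refl with ℕ.m≤n⇒m<n∨m≡n p
  ... | inj₁ b+k≤N = ∈-++⁺ˡ (∈-bounded⁺ (over (s≤s⁻¹ b+k≤N) B))
  ... | inj₂ eq = ∈-++⁺ʳ (bounded N m n) (∈-++⁺ʳ (withPlain (suc N) m n)
    (subst (λ M → over (suc b) ∷ ρ ∈ withOvers M m n) (trans (ℕ.+-comm k b) eq) (∈-withOvers⁺ B)))

  split-unique : ∀ N m n → Unique (split N m n)
  split-unique N m n = Unique.++⁺ (bounded-unique N m n)
    (Unique.++⁺ withPlain-unique withOvers-unique plain≢over) new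
    where
    -- A predicate disguised as a relation that ignores its second argument, so that `shift-rel`
    -- applies; the natural numbers supplied below are dummies.
    unique : List (List Part) → ℕ → Set
    unique xs _ = Unique xs

    withPlain-unique : Unique (withPlain (suc N) m n)
    withPlain-unique = shift-rel unique {z′ = 0} {g = λ j → j} []
      (λ j → Unique.map⁺ (λ { refl → refl }) (bounded-unique (suc N) m j)) (suc N) n

    withOvers-unique : Unique (withOvers (suc N) m n)
    withOvers-unique = shift-rel unique {z′ = 0} {g = λ j → j} []
      (λ b → shift-rel unique {z′ = 0} {g = λ j → j} []
        (λ m → shift-rel unique {z′ = 0} {g = λ j → j} []
          (λ n → Unique.map⁺ (λ { refl → refl }) (bounded-unique b m n)) (suc b) n) 1 m) k (suc N)

    plain≢over : ∀ {π} → π ∈ withPlain (suc N) m n × π ∈ withOvers (suc N) m n → _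
    plain≢over (i , j) with ∈-withPlain⁻ N m n i | ∈-withOvers⁻ (suc N) m n j
    ... | _ , refl , _ | _ , _ , _ , () , _

    new : ∀ {π} → π ∈ bounded N m n × π ∈ withPlain (suc N) m n ++ withOvers (suc N) m n → _
    new (i , j) with ∈-++⁻ (withPlain (suc N) m n) j
    new (i , _) | inj₁ j with ∈-bounded⁻ N m n i | ∈-withPlain⁻ N m n j
    ... | plain N<N _ , _ | _ , refl , _ = ℕ.<-irrefl refl N<N
    new (i , _) | inj₂ j with ∈-bounded⁻ N m n i | ∈-withOvers⁻ (suc N) m n j
    ... | over b+k≤N _ , _ | b , _ , eq , refl , _ =
      ℕ.<-irrefl refl (ℕ.≤-trans (ℕ.≤-reflexive (trans eq (ℕ.+-comm k b))) b+k≤N)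

  -- The q-degree n comes before the a-degree m, as in the coefficients of a series over ℤ⟦a⟧.
  count : ℕ → ℕ → ℕ → ℕ
  count N n m = length (bounded N m n)

  count-suc : ∀ N n m → count (suc N) n m ≡ count N n m ℕ.+
    (shift 0 (suc N) (λ n → count (suc N) n m) n ℕ.+
     shift 0 k (λ b → shift 0 1 (λ m → shift 0 (suc b) (λ n → count b n m) n) m) (suc N))
  count-suc N n m = begin
    count (suc N) n m
      ≡⟨ unique-length (bounded-unique (suc N) m n) (split-unique N m n) (mk⇔ (∈-split⁺ N m n) (∈-split⁻ N m n)) ⟩
    length (split N m n)
      ≡⟨ length-++ (bounded N m n) ⟩
    count N n m ℕ.+ length (withPlain (suc N) m n ++ withOvers (suc N) m n)
      ≡⟨ cong (count N n m ℕ.+_) (length-++ (withPlain (suc N) m n)) ⟩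
    count N n m ℕ.+ (length (withPlain (suc N) m n) ℕ.+ length (withOvers (suc N) m n))
      ≡⟨ cong (count N n m ℕ.+_) (cong₂ ℕ._+_
           (shift-rel sized refl (λ j → length-map _ (bounded (suc N) m j)) (suc N) n)
           (shift-rel sized refl (λ b → shift-rel sized refl (λ m → shift-rel sized refl
             (λ n → length-map _ (bounded b m n)) (suc b) n) 1 m) k (suc N))) ⟩
    _ ∎
    where
    open ≡.≡-Reasoning
    sized : List (List Part) → ℕ → Set
    sized xs n = length xs ≡ n

  -- Bound 0 leaves only the empty list: a plain part would need `b < 0`, an overlined one
  -- `b + k ≤ 0`.
  count-0-0-0 : count 0 0 0 ≡ 1
  count-0-0-0 = unique-length (bounded-unique 0 0 0) ([] ∷ []) (mk⇔
    (λ i → to (proj₁ (∈-bounded⁻ 0 0 0 i))) (λ { (here refl) → ∈-bounded⁺ {0} {[]} [] }))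
    where
    to : ∀ {π} → Bounded k 0 π → π ∈ [] ∷ []
    to [] = here refl
    to (over {b = b} p _) = ⊥-elim (ℕ.<⇒≱ k>0 (ℕ.m+n≤o⇒n≤o b p))

  count-0-empty : ∀ n m → (n , m) ≢ (0 , 0) → count 0 n m ≡ 0
  count-0-empty n m ≢0 = unique-length (bounded-unique 0 m n) [] (mk⇔
    (λ i → ⊥-elim (empty (∈-bounded⁻ 0 m n i))) λ ())
    where
    empty : ∀ {π} → Bounded k 0 π × overs π ≡ m × weight π ≡ n → ⊥
    empty ([] , refl , refl) = ≢0 refl
    empty (over {b = b} p _ , _) = ℕ.<⇒≱ k>0 (ℕ.m+n≤o⇒n≤o b p)

-- Power series modulo powers of the variable.

module Truncation {c ℓ} (R : CommutativeRing c ℓ) where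

  private
    module R where
      open CommutativeRing R public
      open SemiringSum semiring public

  open PowerSeries R
  private
    module S where
      open CommutativeRing commutativeRing public
      open RingProperties ring public
  open S using (_≈_; _+_; _*_; _-_; -_; 0#; 1#)
  open SemiringExp S.semiring using (_^_; ^-assocʳ; ^-congʳ)

  const-* : ∀ x f → (const x * f) ≈ λ n → x R.* f n
  const-* x f zero    = R.+-identityʳ _
  const-* x f (suc n) = R.trans
    (R.+-congˡ (R.trans (R.sum-cong-≋ {n = suc n} (λ i → R.zeroˡ (f (n ∸ toℕ i)))) (R.sum-replicate-zero (suc n))))
    (R.+-identityʳ _)

  X-* : ∀ f → (X * f) ≈ shift R.0# 1 f
  X-* f zero    = R.trans (R.+-identityʳ _) (R.zeroˡ _)
  X-* f (suc n) = R.trans (R.+-congʳ (R.zeroˡ _)) (R.trans (R.+-identityˡ _) (R.trans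
    (R.sum-cong-≋ {n = suc n} (λ i → R.*-congʳ {f (n ∸ toℕ i)} (X-suc (toℕ i)))) (S.*-identityˡ f n)))
    where
    X-suc : ∀ i → X (suc i) R.≈ const R.1# i
    X-suc zero    = R.refl
    X-suc (suc i) = R.refl

  X^-* : ∀ N f → (X ^ N * f) ≈ shift R.0# N f
  X^-* zero    f n = S.*-identityˡ f n
  X^-* (suc N) f n = R.trans (S.*-assoc X (X ^ N) f n) (R.trans (X-* (X ^ N * f) n) (step n))
    where
    step : shift R.0# 1 (X ^ N * f) ≈ shift R.0# (suc N) f
    step zero    = R.refl
    step (suc n) = X^-* N f n

  infix 4 _≈[_]_
  -- Congruence modulo `X ^ M`.
  _≈[_]_ : Series → ℕ → Series → Set ℓ
  f ≈[ M ] g = ∀ {n} → n < M → f n R.≈ g n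

  truncated : ℕ → Setoid c ℓ
  truncated M = record
    { Carrier = Series ; _≈_ = _≈[ M ]_
    ; isEquivalence = record
      { refl = λ _ → R.refl ; sym = λ p n<M → R.sym (p n<M) ; trans = λ p r n<M → R.trans (p n<M) (r n<M) } }

  module T {M} = Setoid (truncated M)

  ≈⇒≈[] : ∀ {M f g} → f ≈ g → f ≈[ M ] g
  ≈⇒≈[] p {n} _ = p n

  ≈[]-mono : ∀ {L M f g} → L ≤ M → f ≈[ M ] g → f ≈[ L ] g
  ≈[]-mono L≤M p n<L = p (ℕ.≤-trans n<L L≤M)

  +-cong[] : ∀ {M f f′ g g′} → f ≈[ M ] f′ → g ≈[ M ] g′ → (f + g) ≈[ M ] (f′ + g′)
  +-cong[] p r n<M = R.+-cong (p n<M) (r n<M)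

  *-cong[] : ∀ {M f f′ g g′} → f ≈[ M ] f′ → g ≈[ M ] g′ → (f * g) ≈[ M ] (f′ * g′)
  *-cong[] p r {n} n<M = R.sum-cong-≋ {n = suc n} λ i → R.*-cong
    (p (ℕ.≤-<-trans (s≤s⁻¹ (toℕ<n i)) n<M)) (r (ℕ.≤-<-trans (ℕ.m∸n≤m n (toℕ i)) n<M))

  X-*-cong[] : ∀ {M f g} → f ≈[ M ] g → (X * f) ≈[ suc M ] (X * g)
  X-*-cong[] {M} {f} {g} p {n} n<M =
    R.trans (X-* f n) (R.trans (step n n<M) (R.sym (X-* g n)))
    where
    step : ∀ n → n < suc M → shift R.0# 1 f n R.≈ shift R.0# 1 g n
    step zero    _       = R.refl
    step (suc n) (s≤s p′) = p p′

  X^-*-vanish : ∀ M f → (X ^ M * f) ≈[ M ] 0#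
  X^-*-vanish zero    f ()
  X^-*-vanish (suc M) f = T.trans (≈⇒≈[] (S.*-assoc X (X ^ M) f))
    (T.trans (X-*-cong[] (X^-*-vanish M f)) (≈⇒≈[] (S.zeroʳ X)))

  -- Each coefficient has its own threshold; below degree M there are finitely many, and their
  -- maximum serves.
  ⟶⇒≈[] : ∀ {s f} → s ⟶ f → ∀ M → ∃[ t₀ ] ∀ t → t₀ ≤ t → s t ≈[ M ] f
  ⟶⇒≈[] p zero    = 0 , λ _ _ ()
  ⟶⇒≈[] {s} {f} p (suc M) with p M | ⟶⇒≈[] p M
  ... | t₁ , p₁ | t₂ , p₂ = t₁ ⊔ t₂ , λ t t₀≤t {n} n<1+M → close t t₀≤t (ℕ.m≤n⇒m<n∨m≡n (s≤s⁻¹ n<1+M))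
    where
    close : ∀ t → t₁ ⊔ t₂ ≤ t → ∀ {n} → _ → s t n R.≈ f n
    close t t₀≤t (inj₁ n<M)    = p₂ t (ℕ.m⊔n≤o⇒n≤o t₁ t₂ t₀≤t) n<M
    close t t₀≤t (inj₂ refl)   = p₁ t (ℕ.m⊔n≤o⇒m≤o t₁ t₂ t₀≤t)

  *⇒/ : ∀ {f g h} → g 0 R.≈ R.1# → f * g ≈ h → f ≈ h / g
  *⇒/ {f} {g} {h} g₀ p = begin
    f              ≈⟨ S.*-identityʳ f ⟨
    f * 1#         ≈⟨ S.*-congˡ {f} (1/-correct g g₀) ⟨
    f * (g * 1/ g) ≈⟨ S.*-assoc f g (1/ g) ⟨
    f * g * 1/ g   ≈⟨ S.*-congʳ {1/ g} p ⟩
    h / g          ∎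
    where open ≈-Reasoning S.setoid

  -- Evaluation of truncated generating functions.

  -- Horner's scheme for ∑ x^N * f N over N < M.
  eval : Series → (ℕ → Series) → ℕ → Series
  eval x f zero    = 0#
  eval x f (suc M) = f 0 + x * eval x (λ N → f (suc N)) M

  eval-cong : ∀ x {f g} M → (∀ N → f N ≈ g N) → eval x f M ≈ eval x g M
  eval-cong x zero    p = S.refl
  eval-cong x {f} {g} (suc M) p = S.+-cong (p 0) (S.*-congˡ {x} (eval-cong x M (λ N → p (suc N))))

  eval-+ : ∀ x f g M → eval x (λ N → f N + g N) M ≈ eval x f M + eval x g M
  eval-+ x f g zero    = S.sym (S.+-identityˡ 0#)
  eval-+ x f g (suc M) = begin
    f 0 + g 0 + x * eval x (λ N → f (suc N) + g (suc N)) M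
      ≈⟨ S.+-congˡ {f 0 + g 0} (S.*-congˡ {x} (eval-+ x _ _ M)) ⟩
    f 0 + g 0 + x * (F + G)
      ≈⟨ S.+-congˡ {f 0 + g 0} (S.distribˡ x F G) ⟩
    f 0 + g 0 + (x * F + x * G)
      ≈⟨ +-interchange (f 0) (g 0) (x * F) (x * G) ⟩
    f 0 + x * F + (g 0 + x * G) ∎
    where
    open ≈-Reasoning S.setoid
    open CommutativeSemigroupProperties S.+-commutativeSemigroup
      renaming (interchange to +-interchange)
    F = eval x (λ N → f (suc N)) M
    G = eval x (λ N → g (suc N)) M

  eval-* : ∀ x y f M → eval x (λ N → y * f N) M ≈ y * eval x f M
  eval-* x y f zero    = S.sym (S.zeroʳ y)
  eval-* x y f (suc M) = begin
    y * f 0 + x * eval x (λ N → y * f (suc N)) M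
      ≈⟨ S.+-congˡ {y * f 0} (S.*-congˡ {x} (eval-* x y _ M)) ⟩
    y * f 0 + x * (y * F)   ≈⟨ S.+-congˡ {y * f 0} (x∙yz≈y∙xz x y F) ⟩
    y * f 0 + y * (x * F)   ≈⟨ S.distribˡ y (f 0) (x * F) ⟨
    y * (f 0 + x * F)       ∎
    where
    open ≈-Reasoning S.setoid
    open CommutativeSemigroupProperties S.*-commutativeSemigroup using (x∙yz≈y∙xz)
    F = eval x (λ N → f (suc N)) M

  -- Powers of y in the terms are absorbed into the argument; for y = q this is how E(qx) arises.
  eval-^ : ∀ x y f M → eval x (λ N → y ^ N * f N) M ≈ eval (y * x) f M
  eval-^ x y f zero    = S.refl
  eval-^ x y f (suc M) = S.+-cong (S.*-identityˡ (f 0)) (begin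
    x * eval x (λ N → y * y ^ N * f (suc N)) M
      ≈⟨ S.*-congˡ {x} (eval-cong x M (λ N → S.*-assoc y (y ^ N) (f (suc N)))) ⟩
    x * eval x (λ N → y * (y ^ N * f (suc N))) M
      ≈⟨ S.*-congˡ {x} (eval-* x y (λ N → y ^ N * f (suc N)) M) ⟩
    x * (y * eval x (λ N → y ^ N * f (suc N)) M)
      ≈⟨ S.*-assoc x y _ ⟨
    x * y * eval x (λ N → y ^ N * f (suc N)) M
      ≈⟨ S.*-cong (S.*-comm x y) (eval-^ x y (λ N → f (suc N)) M) ⟩
    y * x * eval (y * x) (λ N → f (suc N)) M ∎)
    where open ≈-Reasoning S.setoid

  -- A delay by k pushes the last k terms out of the sum, so only M of them remain on the right.
  eval-shift : ∀ x k f M → eval x (shift 0# k f) (k ℕ.+ M) ≈ x ^ k * eval x f M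
  eval-shift x zero    f M = S.sym (S.*-identityˡ _)
  eval-shift x (suc k) f M = begin
    0# + x * eval x (shift 0# k f) (k ℕ.+ M)  ≈⟨ S.+-identityˡ _ ⟩
    x * eval x (shift 0# k f) (k ℕ.+ M)       ≈⟨ S.*-congˡ {x} (eval-shift x k f M) ⟩
    x * (x ^ k * eval x f M)                  ≈⟨ S.*-assoc x (x ^ k) _ ⟨
    x ^ suc k * eval x f M                    ∎
    where open ≈-Reasoning S.setoid

  -- Stands in for the factor 1 - x at x = 1, where the infinite sum need not converge: consecutive
  -- partial sums differ by one term.
  eval-1-suc : ∀ f M → eval 1# f (suc M) ≈ eval 1# f M + f M
  eval-1-suc f zero    = begin
    f 0 + 1# * 0#  ≈⟨ S.+-congˡ {f 0} (S.zeroʳ 1#) ⟩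
    f 0 + 0#       ≈⟨ S.+-comm (f 0) 0# ⟩
    0# + f 0       ∎
    where open ≈-Reasoning S.setoid
  eval-1-suc f (suc M) = begin
    f 0 + 1# * eval 1# g (suc M)    ≈⟨ S.+-congˡ {f 0} (S.*-identityˡ _) ⟩
    f 0 + eval 1# g (suc M)         ≈⟨ S.+-congˡ {f 0} (eval-1-suc g M) ⟩
    f 0 + (eval 1# g M + g M)       ≈⟨ S.+-assoc (f 0) _ (g M) ⟨
    f 0 + eval 1# g M + g M         ≈⟨ S.+-congʳ {g M} (S.+-congˡ {f 0} (S.*-identityˡ _)) ⟨
    f 0 + 1# * eval 1# g M + g M    ∎
    where
    open ≈-Reasoning S.setoid
    g = λ N → f (suc N)

  -- The argument is divisible by X, so the terms from index M on vanish modulo `X ^ M`.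
  eval-stable : ∀ y f {M L} → M ≤ L → eval (X * y) f L ≈[ M ] eval (X * y) f M
  eval-stable y f z≤n       ()
  eval-stable y f {suc M} {suc L} (s≤s M≤L) = +-cong[] (T.refl {x = f 0}) (begin
    X * y * F L    ≈⟨ ≈⇒≈[] (S.*-assoc X y (F L)) ⟩
    X * (y * F L)  ≈⟨ X-*-cong[] {M} {y * F L} {y * F M}
                        (*-cong[] {g = F L} {F M} (T.refl {x = y}) (eval-stable y (λ N → f (suc N)) M≤L)) ⟩
    X * (y * F M)  ≈⟨ ≈⇒≈[] (S.*-assoc X y (F M)) ⟨
    X * y * F M    ∎)
    where
    open ≈-Reasoning (truncated (suc M))
    F = eval (X * y) (λ N → f (suc N))

  -- The truncated form of evaluation at 0.
  eval-head : ∀ M f L → eval (X ^ M) f (suc L) ≈[ M ] f 0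
  eval-head M f L = T.trans (+-cong[] (T.refl {x = f 0}) (X^-*-vanish M (eval (X ^ M) (λ N → f (suc N)) L)))
    (≈⇒≈[] (S.+-identityʳ (f 0)))

  -- The functional equation and its iteration.

  module _ (a : Series) (k : ℕ) (r : ℕ → Series) (r₀ : r 0 ≈ 1#)
    (recurrence : ∀ N → r N ≈ shift 0# 1 r N + (X ^ N * r N + shift 0# (suc k) (λ b → a * (X ^ suc b * r b)) N))
    where

    private
      b : Series
      b = - (a * X)

      collect : ∀ x y → y + x * (a * X * y) ≈ (1# - b * x) * y
      collect x y = S.sym (begin
        (1# - b * x) * y         ≈⟨ S.distribʳ y 1# (- (b * x)) ⟩
        1# * y + - (b * x) * y   ≈⟨ S.+-cong (S.*-identityˡ y) (S.*-congʳ {y} neg) ⟩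
        y + a * X * x * y        ≈⟨ S.+-congˡ {y} (S.trans (S.*-congʳ {y} (S.*-comm (a * X) x)) (S.*-assoc x (a * X) y)) ⟩
        y + x * (a * X * y)      ∎)
        where
        open ≈-Reasoning S.setoid
        neg : - (b * x) ≈ a * X * x
        neg = S.trans (S.-‿distribˡ-* b x) (S.*-congʳ {x} (S.-‿involutive (a * X)))

    -- The functional equation for finite sums, with no precision lost: each delay shortens its sum,
    -- hence the different lengths. The term with x stays on the right, so that x = 1 is allowed.
    eval-recurrence : ∀ x M → eval x r (suc k ℕ.+ M) ≈
      x * eval x r (k ℕ.+ M) + (eval (X * x) r (suc k ℕ.+ M) + x ^ suc k * (a * X * eval (X * x) r M))
    eval-recurrence x M = begin
      eval x r K
        ≈⟨ eval-cong x K recurrence ⟩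
      eval x (λ N → shift 0# 1 r N + (X ^ N * r N + h N)) K
        ≈⟨ eval-+ x (shift 0# 1 r) (λ N → X ^ N * r N + h N) K ⟩
      eval x (shift 0# 1 r) K + eval x (λ N → X ^ N * r N + h N) K
        ≈⟨ S.+-cong (eval-shift x 1 r (k ℕ.+ M)) (eval-+ x (λ N → X ^ N * r N) h K) ⟩
      x ^ 1 * eval x r (k ℕ.+ M) + (eval x (λ N → X ^ N * r N) K + eval x h K)
        ≈⟨ S.+-cong (S.*-congʳ {eval x r (k ℕ.+ M)} (S.*-identityʳ x)) (S.+-cong (eval-^ x X r K)
             (S.trans (eval-shift x (suc k) g M) (S.*-congˡ {x ^ suc k} inner))) ⟩
      x * eval x r (k ℕ.+ M) + (eval (X * x) r K + x ^ suc k * (a * X * eval (X * x) r M))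
        ∎
      where
      open ≈-Reasoning S.setoid
      K = suc k ℕ.+ M
      g = λ b → a * (X ^ suc b * r b)
      h = shift 0# (suc k) g
      inner : eval x g M ≈ a * X * eval (X * x) r M
      inner = begin
        eval x g M
          ≈⟨ eval-cong x M (λ b → S.trans (S.*-congˡ {a} (S.*-assoc X (X ^ b) (r b))) (S.sym (S.*-assoc a X (X ^ b * r b)))) ⟩
        eval x (λ b → a * X * (X ^ b * r b)) M
          ≈⟨ eval-* x (a * X) (λ b → X ^ b * r b) M ⟩
        a * X * eval x (λ b → X ^ b * r b) M
          ≈⟨ S.*-congˡ {a * X} (eval-^ x X r M) ⟩
        a * X * eval (X * x) r M ∎

    -- At x = 1 the partial sum of length `k + M` occurs on both sides and cancels, leaving the
    -- single term `r (k + M)`. The factors `1#` are kept to match `X ^ 1` and the first Pochhammer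
    -- factor.
    r-eval : ∀ M → r (k ℕ.+ M) ≈[ M ] (1# - b * 1#) * eval (X * 1#) r M
    r-eval M = begin
      r (k ℕ.+ M)
        ≈⟨ ≈⇒≈[] (S.+-cancelˡ (eval 1# r (k ℕ.+ M)) _ _ (S.trans (S.sym (eval-1-suc r (k ℕ.+ M)))
             (S.trans (eval-recurrence 1# M) (S.+-cong (S.*-identityˡ _) (S.+-congˡ {E (suc k ℕ.+ M)} (S.*-congʳ (1^ (suc k)))))))) ⟩
      E (suc k ℕ.+ M) + 1# * (a * X * E M)
        ≈⟨ +-cong[] (eval-stable 1# r (ℕ.m≤n+m M (suc k))) (T.refl {x = 1# * (a * X * E M)}) ⟩
      E M + 1# * (a * X * E M)
        ≈⟨ ≈⇒≈[] (collect 1# (E M)) ⟩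
      (1# - b * 1#) * E M ∎
      where
      open ≈-Reasoning (truncated M)
      E = eval (X * 1#) r
      1^ : ∀ n → 1# ^ n ≈ 1#
      1^ zero    = S.refl
      1^ (suc n) = S.trans (S.*-identityˡ _) (1^ n)

    -- Here x is divisible by X, so all lengths in the functional equation may be cut to M and the
    -- terms with x collected.
    eval-step : ∀ y M → let x = X * y in
      eval x r M * (1# - x) ≈[ M ] (1# - b * x ^ suc k) * eval (X * x) r M
    eval-step y M = begin
      E * (1# - x)
        ≈⟨ ≈⇒≈[] (S.trans (S.distribˡ E 1# (- x)) (S.+-cong (S.*-identityʳ E)
             (S.trans (S.*-comm E (- x)) (S.sym (S.-‿distribˡ-* x E))))) ⟩
      E - x * E
        ≈⟨ +-cong[] unfolded (T.refl {x = - (x * E)}) ⟩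
      (x * E + G) - x * E
        ≈⟨ ≈⇒≈[] (S.xyx⁻¹≈y (x * E) G) ⟩
      G
        ≈⟨ ≈⇒≈[] (collect (x ^ suc k) F) ⟩
      (1# - b * x ^ suc k) * F ∎
      where
      open ≈-Reasoning (truncated M)
      x = X * y
      E = eval x r M
      F = eval (X * x) r M
      G = F + x ^ suc k * (a * X * F)
      unfolded : E ≈[ M ] x * E + G
      unfolded = begin
        E                          ≈⟨ eval-stable y r (ℕ.m≤n+m M (suc k)) ⟨
        eval x r (suc k ℕ.+ M)     ≈⟨ ≈⇒≈[] (eval-recurrence x M) ⟩
        x * eval x r (k ℕ.+ M) + (eval (X * x) r (suc k ℕ.+ M) + x ^ suc k * (a * X * F))
          ≈⟨ +-cong[] (*-cong[] (T.refl {x = x}) (eval-stable y r (ℕ.m≤n+m M k)))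
               (+-cong[] (eval-stable x r (ℕ.m≤n+m M (suc k))) (T.refl {x = x ^ suc k * (a * X * F)})) ⟩
        x * E + G ∎

    -- Induction on t, one `eval-step` each time. The numerator is one factor ahead because the
    -- start at x = 1 contributes a factor only on the right.
    r-pochhammer : ∀ M t → (r (k ℕ.+ M) * ⟨ X ⍮ X ⟩ t) ≈[ M ]
                   (⟨ b ⍮ X ^ suc k ⟩ suc t) * eval (X ^ suc t) r M
    r-pochhammer M zero = T.trans (≈⇒≈[] (S.*-identityʳ (r (k ℕ.+ M))))
      (T.trans (r-eval M) (≈⇒≈[] (S.*-congʳ {eval (X * 1#) r M} (S.sym (S.*-identityˡ (1# - b * 1#))))))
    r-pochhammer M (suc t) = begin
      r (k ℕ.+ M) * (⟨ X ⍮ X ⟩ t * (1# - x))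
        ≈⟨ ≈⇒≈[] (S.*-assoc (r (k ℕ.+ M)) (⟨ X ⍮ X ⟩ t) (1# - x)) ⟨
      r (k ℕ.+ M) * ⟨ X ⍮ X ⟩ t * (1# - x)
        ≈⟨ *-cong[] (r-pochhammer M t) (T.refl {x = 1# - x}) ⟩
      P * eval x r M * (1# - x)
        ≈⟨ ≈⇒≈[] (S.*-assoc P (eval x r M) (1# - x)) ⟩
      P * (eval x r M * (1# - x))
        ≈⟨ *-cong[] (T.refl {x = P}) (eval-step (X ^ t) M) ⟩
      P * ((1# - b * x ^ suc k) * eval (X * x) r M)
        ≈⟨ ≈⇒≈[] (S.*-assoc P (1# - b * x ^ suc k) (eval (X * x) r M)) ⟨
      P * (1# - b * x ^ suc k) * eval (X * x) r M
        ≈⟨ ≈⇒≈[] (S.*-congʳ {eval (X * x) r M} (S.*-congˡ {P} (S.+-congˡ {1#} (S.-‿cong (S.*-congˡ {b} swap))))) ⟩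
      P * (1# - b * (X ^ suc k) ^ suc t) * eval (X * x) r M ∎
      where
      open ≈-Reasoning (truncated M)
      x = X ^ suc t
      P = ⟨ b ⍮ X ^ suc k ⟩ suc t
      swap : x ^ suc k ≈ (X ^ suc k) ^ suc t
      swap = S.trans (^-assocʳ X (suc t) (suc k))
        (S.trans (^-congʳ X (ℕ.*-comm (suc t) (suc k))) (S.sym (^-assocʳ X (suc k) (suc t))))

    -- Modulo `X ^ suc t` the remaining sum, taken at `X ^ suc t`, reduces to `r 0`, which is 1.
    r-pochhammer-∞ : ∀ t → (r (k ℕ.+ suc t) * ⟨ X ⍮ X ⟩ t) ≈[ suc t ] (⟨ b ⍮ X ^ suc k ⟩ suc t)
    r-pochhammer-∞ t = T.trans (r-pochhammer (suc t) t) (T.trans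
      (*-cong[] (T.refl {x = ⟨ b ⍮ X ^ suc k ⟩ suc t}) (T.trans (eval-head (suc t) r t) (≈⇒≈[] r₀)))
      (≈⇒≈[] (S.*-identityʳ (⟨ b ⍮ X ^ suc k ⟩ suc t))))

    limit : ∀ f → (∀ M → ∃[ t₀ ] ∀ t → t₀ ≤ t → r (k ℕ.+ suc t) ≈[ M ] f) →
            f ≈ ⟨ b ⍮ X ^ suc k ⟩∞ / ⟨ X ⍮ X ⟩∞
    limit f p = *⇒/ (⟨⍮⟩∞-constant X X R.refl) product
      where
      Xᵏ₀ : (X ^ suc k) 0 R.≈ R.0#
      Xᵏ₀ = X-* (X ^ k) 0
      product : f * ⟨ X ⍮ X ⟩∞ ≈ ⟨ b ⍮ X ^ suc k ⟩∞
      product n with p (suc n) | ⟶⇒≈[] (⟨⍮⟩∞-correct X X R.refl) (suc n)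
                   | ⟶⇒≈[] (⟨⍮⟩∞-correct b (X ^ suc k) Xᵏ₀) (suc n)
      ... | t₁ , p₁ | t₂ , p₂ | t₃ , p₃ = T.trans
        (*-cong[] (T.sym (p₁ t t₁≤t)) (T.sym (p₂ t t₂≤t)))
        (T.trans (≈[]-mono (s≤s n≤t) (r-pochhammer-∞ t)) (p₃ (suc t) t₃≤t)) (ℕ.n<1+n n)
        where
        -- Large enough for the coefficient n and for all three thresholds at once.
        t = n ℕ.+ (t₁ ℕ.+ (t₂ ℕ.+ t₃))
        n≤t = ℕ.m≤m+n n (t₁ ℕ.+ (t₂ ℕ.+ t₃))
        t₁≤t = ℕ.≤-trans (ℕ.m≤m+n t₁ (t₂ ℕ.+ t₃)) (ℕ.m≤n+m _ n)
        t₂≤t = ℕ.≤-trans (ℕ.≤-trans (ℕ.m≤m+n t₂ t₃) (ℕ.m≤n+m _ t₁)) (ℕ.m≤n+m _ n)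
        t₃≤t = ℕ.m≤n⇒m≤1+n (ℕ.≤-trans (ℕ.≤-trans (ℕ.m≤n+m t₃ t₂) (ℕ.m≤n+m _ t₁)) (ℕ.m≤n+m _ n))

-- The generating function of bounded overpartitions.

private
  module Q = Truncation ℤ⟦a⟧.commutativeRing
  module Z = Truncation ℤ.+-*-commutativeRing
  module S = CommutativeRing ℤ⟦a⟧⟦q⟧.commutativeRing

open Defs using
  (_≈_; _*_; -_; 1#; _^_; Series; ⟨_⍮_⟩∞; _/_; a; q)

module _ {k} (2≤k : 2 ≤ suc k) where

  -- The series r N of the recurrence; the k of the theorem is `suc k` here.
  gf : ℕ → Series
  gf N n m = ℤ.+ count 2≤k N n m

  gf-zero : gf 0 ≈ 1#
  gf-zero zero    zero    = cong ℤ.+_ (count-0-0-0 2≤k)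
  gf-zero zero    (suc m) = cong ℤ.+_ (count-0-empty 2≤k 0 (suc m) λ ())
  gf-zero (suc n) m       = cong ℤ.+_ (count-0-empty 2≤k (suc n) m λ ())

  q^-gf : ∀ K N n m → (q ^ K * gf N) n m ≡ ℤ.+ shift 0 K (λ n → count 2≤k N n m) n
  q^-gf K N n m = trans (Q.X^-* K (gf N) n m)
    (shift-rel (λ f j → f m ≡ ℤ.+ j) {z = λ _ → ℤ.+ 0} {f = gf N} refl (λ _ → refl) K n)

  a-q^-gf : ∀ K N n m → (a * (q ^ K * gf N)) n m ≡
            ℤ.+ shift 0 1 (λ m → shift 0 K (λ n → count 2≤k N n m) n) m
  a-q^-gf K N n m = trans (Q.const-* ℤ⟦a⟧.X (q ^ K * gf N) n m)
    (trans (Z.X-* ((q ^ K * gf N) n) m)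
      (shift-rel (λ i j → i ≡ ℤ.+ j) refl (q^-gf K N n) 1 m))

  gf-recurrence : ∀ N → gf N ≈ shift S.0# 1 gf N S.+
    (q ^ N * gf N S.+ shift S.0# (suc k) (λ b → a * (q ^ suc b * gf b)) N)
  -- At N = 0 both delayed terms vanish and `q ^ 0 * gf 0` is the left side itself, so no initial
  -- term enters the functional equation.
  gf-recurrence zero = S.sym (S.trans (S.+-identityˡ (1# * gf 0 S.+ S.0#))
    (S.trans (S.+-identityʳ (1# * gf 0)) (S.*-identityˡ (gf 0))))
  gf-recurrence (suc N) n m = trans (cong ℤ.+_ (count-suc 2≤k N n m))
    (cong (ℤ._+_ (gf N n m)) (sym (cong₂ ℤ._+_ (q^-gf (suc N) (suc N) n m)
      (shift-rel (λ f j → f n m ≡ ℤ.+ j) {z = S.0#} {f = λ b → a * (q ^ suc b * gf b)} refl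
        (λ b → a-q^-gf (suc b) b n m) k N))))

  -- For n below M, the bound `k + suc t` with `M ≤ t` no longer restricts overpartitions of n.
  gf-limit : ∀ M → ∃[ t₀ ] ∀ t → t₀ ≤ t → gf (k ℕ.+ suc t) Q.≈[ M ] ∑D (suc k)
  gf-limit M = M , λ t M≤t {n} n<M m → cong ℤ.+_ (length-bounded 2≤k m n (large t n (ℕ.<-≤-trans n<M M≤t)))
    where
    large : ∀ t n → n < t → n ℕ.+ suc k ≤ suc (k ℕ.+ suc t)
    large t n n<t = begin
      n ℕ.+ suc k           ≡⟨ ℕ.+-comm n (suc k) ⟩
      suc (k ℕ.+ n)         ≤⟨ s≤s (ℕ.+-monoʳ-≤ k (ℕ.m≤n⇒m≤1+n (ℕ.<⇒≤ n<t))) ⟩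
      suc (k ℕ.+ suc t)     ∎
      where open ℕ.≤-Reasoning

theorem4 : (k : ℕ) → 2 ≤ k → ∑D k ≈ ⟨ - (a * q) ⍮ q ^ k ⟩∞ / ⟨ q ⍮ q ⟩∞
theorem4 (suc k) 2≤k =
  Q.limit a k (gf 2≤k) (gf-zero 2≤k) (gf-recurrence 2≤k) (∑D (suc k)) (gf-limit 2≤k)
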